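{- The ideal $\mathcal L$ on $\omega$ generated by lacunary sets is not $\le_K$-homogeneous (in particular, it is not homogeneous).
   Context: An ideal on a set $X$ is a family of subsets of $X$ closed under finite unions and subsets, containing all finite subsets of $X$ and not containing $X$; $\mathcal I^+=\mathcal P(X)\setminus\mathcal I$. A set $A\subseteq\omega$ is lacunary if $\lim_{n}(a_{n+1}-a_n)=\infty$, where $(a_n)$ is the increasing enumeration of $A$; $\mathcal L$ consists of all subsets of finite unions of lacunary sets (and finite sets). For ideals $\mathcal I$ on $X$ and $\mathcal K$ on $Y$, $\mathcal I\le_K\mathcal K$ (Katětov order) means that there is $f:Y\to X$ with $f^{ -1}[B]\in\mathcal K$ for all $B\in\mathcal I$; $\mathcal I$ and $\mathcal K$ are isomorphic if there is a bijection $f:Y\to X$ with $f^{ -1}[B]\in\mathcal K\iff B\in\mathcal I$. For $A\in\mathcal I^+$, $\mathcal I\restriction A=\{B\cap A:B\in\mathcal I\}$ (an ideal on $A$). $\mathcal I$ is homogeneous if $\mathcal I\restriction A$ is isomorphic to $\mathcal I$ for each $A\in\mathcal I^+$, and $\le_K$-homogeneous if $\mathcal I\restriction A\le_K\mathcal I$ and $\mathcal I\le_K\mathcal I\restriction A$ for each $A\in\mathcal I^+$. -}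

module Defs where

open import Data.Fin using (Fin; toℕ)
open import Data.Fin.Properties using (pigeonhole; toℕ<n)
open import Data.List using (List; []; _∷_; [_]; _++_; length; map; lookup)
open import Data.List.Extrema.Nat using (max; xs≤max)
open import Data.List.Membership.Setoid using () renaming (_∈_ to _⊢_∈ₗ_)
open import Data.List.Membership.Setoid.Properties using (∈-map⁺)
open import Data.List.Relation.Unary.All as All using (All; []; _∷_)
import Data.List.Relation.Unary.All.Properties as All
open import Data.List.Relation.Unary.Any as Any using (Any; here; there)
import Data.List.Relation.Unary.Any.Properties as Any
open import Data.Nat using (ℕ; suc; _+_; _∸_; _⊔_; _≤_; _<_; _≤′_; ≤′-refl; ≤′-step)
open import Data.Nat.Properties using
  ( ≤-refl; ≤-trans; <⇒≤; <⇒≱; ≰⇒>; ≮⇒≥; <-≤-trans; ≤⇒≤′; m≤m⊔n; m≤n⊔m; m≤m+n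
  ; +-monoʳ-<; ∸-monoˡ-≤; m∸n≤m; [m+n]∸[m+o]≡n∸o; module ≤-Reasoning)
open import Data.Product using (Σ; ∃; _×_; _,_; proj₁; proj₂)
open import Data.Sum using (_⊎_; inj₁; inj₂; [_,_]′)
open import Data.Unit using (⊤; tt)
open import Function using (id; _∘_)
open import Function.Bundles using (Func; Bijection; Injection; Equivalence; _⇔_; mk⇔)
open import Level using (0ℓ)
open import Relation.Binary.Bundles using (Setoid)
import Relation.Binary.Construct.On as On
open import Relation.Binary.Definitions using (_Respects_)
open import Relation.Binary.PropositionalEquality as ≡ using (_≡_; refl)
open import Relation.Nullary using (¬_; contradiction)
open import Relation.Unary using (Pred)

-- A set is a setoid, so that a subset A of X is again a set (see `Sub`)
-- in which x ∈ A counts once, regardless of how membership is proved.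
Space : Set₁
Space = Setoid 0ℓ 0ℓ

private
  variable
    X Y : Space

record Subset (X : Space) : Set₁ where
  open Setoid X using (Carrier; _≈_)
  field
    pred : Pred Carrier 0ℓ
    resp : pred Respects _≈_

open Subset public

infix 4 _∈_ _⊆_

_∈_ : Setoid.Carrier X → Subset X → Set
x ∈ A = pred A x

_⊆_ : Subset X → Subset X → Set
A ⊆ B = ∀ x → x ∈ A → x ∈ B

full : Subset X
full = record { pred = λ _ → ⊤ ; resp = λ _ _ → tt }

infixr 6 _∪_

_∪_ : Subset X → Subset X → Subset X
A ∪ B = record
  { pred = λ x → x ∈ A ⊎ x ∈ B
  ; resp = λ x≈y → [ inj₁ ∘ resp A x≈y , inj₂ ∘ resp B x≈y ]′
  }

preimage : Func Y X → Subset X → Subset Y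
preimage f B = record
  { pred = λ y → to y ∈ B
  ; resp = λ y≈z → resp B (cong y≈z)
  }
  where open Func f

-- Being covered by a list is classically equivalent to finiteness.
-- Constructively it is the version that passes to subsets.
Finite : Subset X → Set
Finite {X} A = ∃ λ xs → ∀ x → x ∈ A → X ⊢ x ∈ₗ xs

Sub : (X : Space) → Subset X → Space
Sub X A = On.setoid X (proj₁ {A = Setoid.Carrier X} {B = pred A})

-- The empty union is the empty set, a member by `finite`.
record Ideal (X : Space) : Set₂ where
  field
    Member   : Subset X → Set₁
    ∪-closed : ∀ A B → Member A → Member B → Member (A ∪ B)
    ⊆-closed : ∀ A B → A ⊆ B → Member B → Member A
    finite   : ∀ A → Finite A → Member A
    proper   : ¬ Member full

open Ideal public

infix 4 _∈ᴵ_ _∈⁺_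

_∈ᴵ_ : Subset X → Ideal X → Set₁
A ∈ᴵ I = Member I A

_∈⁺_ : Subset X → Ideal X → Set₁
A ∈⁺ I = ¬ (A ∈ᴵ I)

-- The ideal { B ∩ A : B ∈ I } on A, where C = B ∩ A is read
-- extensionally.
restrict : (I : Ideal X) (A : Subset X) → A ∈⁺ I → Ideal (Sub X A)
restrict {X} I A A∈⁺I = record
  { Member   = λ C → ∃ λ B → B ∈ᴵ I × (∀ a → a ∈ C ⇔ proj₁ a ∈ B)
  ; ∪-closed = λ where
      C D (B , B∈I , C⇔B) (E , E∈I , D⇔E) →
        B ∪ E , ∪-closed I B E B∈I E∈I , λ a → mk⇔
          [ inj₁ ∘ to (C⇔B a) , inj₂ ∘ to (D⇔E a) ]′
          [ inj₁ ∘ from (C⇔B a) , inj₂ ∘ from (D⇔E a) ]′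
  ; ⊆-closed = λ where
      C D C⊆D (B , B∈I , D⇔B) →
        image C
        , ⊆-closed I (image C) B
            (λ x (x∈A , x∈C) → to (D⇔B (x , x∈A)) (C⊆D _ x∈C)) B∈I
        , image-⇔ C
  ; finite   = λ where
      C (xs , C⊆xs) →
        image C
        , finite I (image C)
            (map proj₁ xs , λ x (x∈A , x∈C) →
              ∈-map⁺ (Sub X A) X id {x , x∈A} (C⊆xs (x , x∈A) x∈C))
        , image-⇔ C
  ; proper   = λ where
      (B , B∈I , full⇔B) →
        A∈⁺I (⊆-closed I A B (λ x x∈A → to (full⇔B (x , x∈A)) tt) B∈I)
  }
  where
  open Equivalence using (to; from)

  image : Subset (Sub X A) → Subset X
  image C = record
    { pred = λ x → Σ (x ∈ A) λ x∈A → (x , x∈A) ∈ C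
    ; resp = λ x≈y (x∈A , x∈C) → resp A x≈y x∈A , resp C x≈y x∈C
    }

  image-⇔ : (C : Subset (Sub X A)) → ∀ a → a ∈ C ⇔ proj₁ a ∈ image C
  image-⇔ C (x , x∈A) = mk⇔ (x∈A ,_) λ (_ , x∈C) → resp C (Setoid.refl X) x∈C

infix 4 _≤K_ _≅_

_≤K_ : Ideal X → Ideal Y → Set₁
_≤K_ {X} {Y} I K = Σ (Func Y X) λ f → ∀ B → B ∈ᴵ I → preimage f B ∈ᴵ K

_≅_ : Ideal X → Ideal Y → Set₁
_≅_ {X} {Y} I K = Σ (Bijection Y X) λ f →
  ∀ B → preimage (Injection.function (Bijection.injection f)) B ∈ᴵ K ⇔ B ∈ᴵ I

Homogeneous : Ideal X → Set₁
Homogeneous I = ∀ A (A∈⁺I : A ∈⁺ I) → restrict I A A∈⁺I ≅ I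

≤K-Homogeneous : Ideal X → Set₁
≤K-Homogeneous I = ∀ A (A∈⁺I : A ∈⁺ I) →
  restrict I A A∈⁺I ≤K I × I ≤K restrict I A A∈⁺I

ω : Space
ω = ≡.setoid ℕ

IncreasingEnumeration : (ℕ → ℕ) → Subset ω → Set
IncreasingEnumeration a A =
  (∀ n → a n < a (suc n)) × (∀ x → x ∈ A ⇔ ∃ λ n → a n ≡ x)

TendsToInfinity : (ℕ → ℕ) → Set
TendsToInfinity b = ∀ M → ∃ λ N → ∀ n → N ≤ n → M ≤ b n

Lacunary : Subset ω → Set
Lacunary A = ∃ λ a →
  IncreasingEnumeration a A × TendsToInfinity (λ n → a (suc n) ∸ a n)

-- Lacunary sets are infinite, since they have an infinite increasing
-- enumeration; hence finite sets are admitted separately.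
IsGenerator : Subset ω → Set
IsGenerator A = Lacunary A ⊎ Finite A

InL : Subset ω → Set₁
InL B = ∃ λ As → All IsGenerator As × (∀ x → x ∈ B → Any (x ∈_) As)

private
  Spread : ℕ → ℕ → Subset ω → Set
  Spread D N A = ∀ x y → x ∈ A → y ∈ A → N ≤ x → x < y → D ≤ y ∸ x

  module _ {a : ℕ → ℕ} (a-inc : ∀ n → a n < a (suc n)) where

    mono : ∀ {m n} → m ≤′ n → a m ≤ a n
    mono ≤′-refl       = ≤-refl
    mono (≤′-step m≤n) = ≤-trans (mono m≤n) (<⇒≤ (a-inc _))

    cancel : ∀ {m n} → a m < a n → m < n
    cancel am<an = ≰⇒> λ n≤m → <⇒≱ am<an (mono (≤⇒≤′ n≤m))

    cancel-≤ : ∀ {m n} → a m ≤ a n → m ≤ n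
    cancel-≤ am≤an = ≮⇒≥ λ n<m →
      <⇒≱ (<-≤-trans (a-inc _) (mono (≤⇒≤′ n<m))) am≤an

  spread : ∀ D {A} → IsGenerator A → ∃ λ N → Spread D N A
  spread D (inj₁ (a , (a-inc , enum) , lim)) with lim D
  ... | N , gap = a N , λ x y x∈A y∈A → go (to (enum x) x∈A) (to (enum y) y∈A)
    where
    open Equivalence using (to)
    go : ∀ {x y} → (∃ λ n → a n ≡ x) → (∃ λ n → a n ≡ y) →
         a N ≤ x → x < y → D ≤ y ∸ x
    go (p , refl) (q , refl) N≤x x<y = ≤-trans
      (gap p (cancel-≤ a-inc N≤x))
      (∸-monoˡ-≤ (a p) (mono a-inc (≤⇒≤′ (cancel a-inc x<y))))
  spread D (inj₂ (xs , A⊆xs)) = suc (max 0 xs) , λ x _ x∈A _ N≤x _ →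
    contradiction (All.lookup (xs≤max 0 xs) (A⊆xs _ x∈A)) (<⇒≱ N≤x)

  weaken : ∀ {D M N A} → M ≤ N → Spread D M A → Spread D N A
  weaken M≤N s x y x∈A y∈A N≤x = s x y x∈A y∈A (≤-trans M≤N N≤x)

  spreads : ∀ D {As} → All IsGenerator As → ∃ λ N → All (Spread D N) As
  spreads D []       = 0 , []
  spreads D {A ∷ _} (g ∷ gs) with spread D {A} g | spreads D gs
  ... | M , s | N , ss = M ⊔ N
    , weaken {A = A} (m≤m⊔n M N) s
    ∷ All.map (λ {B} → weaken {D} {A = B} (m≤n⊔m M N)) ss

  -- Of k + 1 consecutive numbers far enough out, two would lie in the
  -- same one of k generators.
  full∉L : ¬ InL full
  full∉L (As , gens , cover) with spreads (suc (length As)) gens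
  ... | N , ss = clash (pigeonhole ≤-refl (λ i → Any.index (c i)))
    where
    c : (i : Fin (suc (length As))) → Any (N + toℕ i ∈_) As
    c i = cover (N + toℕ i) tt

    clash : ¬ (∃ λ i → ∃ λ j → toℕ i < toℕ j × Any.index (c i) ≡ Any.index (c j))
    clash (i , j , i<j , eq) = <⇒≱ (toℕ<n j) (begin
      suc (length As)           ≤⟨ All.lookupAny ss (c j) .proj₁ _ _ i∈ (Any.lookup-index (c j))
                                     (m≤m+n N _) (+-monoʳ-< N i<j) ⟩
      (N + toℕ j) ∸ (N + toℕ i) ≡⟨ [m+n]∸[m+o]≡n∸o N (toℕ j) (toℕ i) ⟩
      toℕ j ∸ toℕ i             ≤⟨ m∸n≤m (toℕ j) (toℕ i) ⟩
      toℕ j                     ∎)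
      where
      open ≤-Reasoning
      i∈ : N + toℕ i ∈ lookup As (Any.index (c j))
      i∈ = ≡.subst (λ k → N + toℕ i ∈ lookup As k) eq (Any.lookup-index (c i))

𝓛 : Ideal ω
𝓛 = record
  { Member   = InL
  ; ∪-closed = λ where
      A B (As , gA , cA) (Bs , gB , cB) →
        As ++ Bs , All.++⁺ gA gB , λ x →
          [ Any.++⁺ˡ ∘ cA x , Any.++⁺ʳ As ∘ cB x ]′
  ; ⊆-closed = λ where
      A B A⊆B (As , gs , c) → As , gs , λ x → c x ∘ A⊆B x
  ; finite   = λ A fin → [ A ] , inj₂ fin ∷ [] , λ _ → here
  ; proper   = full∉L
  }

{-# OPTIONS --safe #-}

-- Let A = { 2^k (2^n + j) : j < 2^k }. For X ∈ 𝓛 there is c such that, for each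
-- d, every far-out window of length c d has a subwindow of length d free of X.
-- Since A contains arbitrarily far runs of 2^k consecutive multiples of 2^k, it
-- is not in 𝓛. But 𝓛 ↾ A contains a copy of Fin ⊗ Fin: the elements of A outside
-- 2^k ℕ lie in the finite union of the lacunary sets { 2^p + r : p ∈ ω } with
-- r < 4^k, and a set whose elements are eventually divisible by each 2^k is
-- contained in a lacunary one. Suppose f : ω → A witnesses 𝓛 ↾ A ≤K 𝓛. For every
-- k there is an interval of length k, starting beyond k, that f maps into 2^k ℕ.
-- The union of these intervals is not in 𝓛, but f maps it into a lacunary set.
module Submission where

open import Defs
open import Data.List using ([]; _∷_; map; upTo)
open import Data.List.Extrema.Nat using (max; xs≤max)
open import Data.List.Membership.Propositional.Properties using (∈-map⁺; ∈-upTo⁺)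
import Data.List.Membership.Propositional as List
open import Data.List.Relation.Unary.All as All using (All; []; _∷_)
import Data.List.Relation.Unary.All.Properties as All
open import Data.List.Relation.Unary.Any using (Any; here; there)
import Data.List.Relation.Unary.Any.Properties as Any
open import Data.Nat
open import Data.Nat.Divisibility
open import Data.Nat.Induction using (<-rec)
open import Data.Nat.Properties
open import Data.Product using (∃; _×_; _,_; proj₁; proj₂)
open import Data.Sum using (_⊎_; inj₁; inj₂; [_,_]′)
open import Function using (id; _∘_)
open import Function.Bundles using (Func; Bijection; Injection; Equivalence; mk⇔)
open import Level using (0ℓ)
open import Relation.Binary.PropositionalEquality using (_≡_; refl; sym; trans; cong; subst)
open import Relation.Nullary using (¬_; Dec; yes; no; contradiction)
open import Relation.Nullary.Decidable using (_×-dec_; _→-dec_)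
open import Relation.Unary using (Pred; Decidable)

-- Powers of two, multiples and increasing sequences.

⟦_⟧ : Pred ℕ 0ℓ → Subset ω
⟦ P ⟧ = record { pred = P ; resp = subst P }

n<2^n : ∀ n → n < 2 ^ n
n<2^n zero    = s≤s z≤n
n<2^n (suc n) = begin-strict
  suc n         ≤⟨ n<2^n n ⟩
  2 ^ n         <⟨ ^-monoʳ-< 2 (s≤s (s≤s z≤n)) (n<1+n n) ⟩
  2 ^ suc n     ∎
  where open ≤-Reasoning

m≤n⇒2^m∣2^n : ∀ {m n} → m ≤ n → 2 ^ m ∣ 2 ^ n
m≤n⇒2^m∣2^n {m} {n} m≤n = divides (2 ^ (n ∸ m))
  (trans (cong (2 ^_) (sym (m∸n+n≡m m≤n))) (^-distribˡ-+-* 2 (n ∸ m) m))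

nearest-multiple : ∀ d .{{_ : NonZero d}} y → ∃ λ q → y ≤ d * q × d * q < y + d
nearest-multiple d zero = 0 , z≤n , subst (_< d) (sym (*-zeroʳ d)) (>-nonZero⁻¹ d)
nearest-multiple d (suc y) with nearest-multiple d y
... | q , y≤dq , dq<y+d with suc y ≤? d * q
... | yes y<dq = q , y<dq , m<n⇒m<1+n dq<y+d
... | no  y≮dq = suc q
  , (begin
      suc y       ≤⟨ s≤s y≤dq ⟩
      1 + d * q   ≤⟨ +-monoˡ-≤ (d * q) (>-nonZero⁻¹ d) ⟩
      d + d * q   ≡⟨ *-suc d q ⟨
      d * suc q   ∎)
  , (begin-strict
      d * suc q   ≡⟨ *-suc d q ⟩
      d + d * q   ≤⟨ +-monoʳ-≤ d (s≤s⁻¹ (≰⇒> y≮dq)) ⟩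
      d + y       ≡⟨ +-comm d y ⟩
      y + d       <⟨ n<1+n _ ⟩
      suc y + d   ∎)
  where open ≤-Reasoning

module _ {a : ℕ → ℕ} (a-inc : ∀ n → a n < a (suc n)) where

  increasing⇒mono : ∀ {m n} → m ≤ n → a m ≤ a n
  increasing⇒mono = go ∘ ≤⇒≤′
    where
    go : ∀ {m n} → m ≤′ n → a m ≤ a n
    go ≤′-refl         = ≤-refl
    go (≤′-step m≤n)   = ≤-trans (go m≤n) (<⇒≤ (a-inc _))

  increasing⇒cancel-< : ∀ {m n} → a m < a n → m < n
  increasing⇒cancel-< am<an = ≰⇒> λ n≤m → <⇒≱ am<an (increasing⇒mono n≤m)

  increasing⇒cancel-≤ : ∀ {m n} → a m ≤ a n → m ≤ n
  increasing⇒cancel-≤ am≤an = ≮⇒≥ λ n<m →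
    <⇒≱ (<-≤-trans (a-inc _) (increasing⇒mono n<m)) am≤an

  increasing⇒inflationary : ∀ n → n ≤ a n
  increasing⇒inflationary zero    = z≤n
  increasing⇒inflationary (suc n) = ≤-<-trans (increasing⇒inflationary n) (a-inc n)

maxBelow : (ℕ → ℕ) → ℕ → ℕ
maxBelow h n = max 0 (map h (upTo n))

≤-maxBelow : ∀ h {i n} → i < n → h i ≤ maxBelow h n
≤-maxBelow h i<n = All.lookup (xs≤max 0 _) (∈-map⁺ h (∈-upTo⁺ i<n))

-- Gaps in members of `𝓛`.

Gap : ∀ {ℓ} → Pred ℕ ℓ → (k x w : ℕ) → Set ℓ
Gap P k x w = ∃ λ y → x ≤ y × y + k ≤ x + w × ∀ z → y ≤ z → z < y + k → ¬ P z

-- Far out, consecutive elements of a lacunary set differ by at least `2 * k`. An element in the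
-- first half of the window therefore keeps the second half free; if there is none, the first half
-- is the gap.
generator-gap : ∀ {A} → IsGenerator A → ∀ k →
  ∃ λ N → ∀ x → N ≤ x → Gap (_∈ A) k x (2 * k)
generator-gap (inj₂ (xs , A⊆xs)) k = suc (max 0 xs) , λ x N≤x →
  x , ≤-refl , +-monoʳ-≤ x (m≤m+n k _) , λ z x≤z _ z∈A →
    <⇒≱ (≤-trans N≤x x≤z) (All.lookup (xs≤max 0 xs) (A⊆xs z z∈A))
generator-gap {A} (inj₁ (a , (a-inc , enum) , lim)) k with lim (2 * k)
... | N , gap = a N , window
  where
  open Equivalence using (to)
  window : ∀ x → a N ≤ x → Gap (_∈ A) k x (2 * k)
  -- Indices below `x + k` suffice, since `i ≤ a i`.
  window x aN≤x with anyUpTo? (λ i → (x ≤? a i) ×-dec (a i <? x + k)) (x + k)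
  ... | yes (i , _ , x≤ai , ai<x+k) = x + k , m≤m+n x k
    , ≤-reflexive (trans (+-assoc x k k) (cong (λ n → x + (k + n)) (sym (+-identityʳ k))))
    , λ z x+k≤z z<x+k+k z∈A → clash z<x+k+k x+k≤z (to (enum z) z∈A)
    where
    clash : ∀ {z} → z < (x + k) + k → x + k ≤ z → ¬ (∃ λ j → a j ≡ z)
    clash z< x+k≤z (j , refl) = <⇒≱ z< (begin
      (x + k) + k              ≡⟨ +-assoc x k k ⟩
      x + (k + k)              ≡⟨ cong (λ n → x + (k + n)) (+-identityʳ k) ⟨
      x + 2 * k                ≤⟨ +-mono-≤ x≤ai
                                    (gap i (increasing⇒cancel-≤ a-inc (≤-trans aN≤x x≤ai))) ⟩
      a i + (a (suc i) ∸ a i)  ≡⟨ m+[n∸m]≡n (<⇒≤ (a-inc i)) ⟩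
      a (suc i)                ≤⟨ increasing⇒mono a-inc
                                    (increasing⇒cancel-< a-inc (<-≤-trans ai<x+k x+k≤z)) ⟩
      a j                      ∎)
      where open ≤-Reasoning
  ... | no none = x , ≤-refl , +-monoʳ-≤ x (m≤m+n k _) , λ z x≤z z<x+k z∈A →
      clash x≤z z<x+k (to (enum z) z∈A)
    where
    clash : ∀ {z} → x ≤ z → z < x + k → ¬ (∃ λ j → a j ≡ z)
    clash x≤z z<x+k (j , refl) =
      none (j , ≤-<-trans (increasing⇒inflationary a-inc j) z<x+k , x≤z , z<x+k)

-- Gaps are nested: a gap of length `c * k` for the first generator serves as the window for the
-- others. Each generator doubles the factor, so `c` depends on their number but not on `k`.
generators-gap : ∀ {As} → All IsGenerator As → ∃ λ c → ∀ k →
  ∃ λ N → ∀ x → N ≤ x → Gap (λ z → Any (z ∈_) As) k x (c * k)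
generators-gap [] = 1 , λ k → 0 , λ x _ →
  x , ≤-refl , ≤-reflexive (cong (x +_) (sym (*-identityˡ k))) , λ _ _ _ ()
generators-gap {A ∷ As} (g ∷ gs) with generators-gap gs
... | c , gaps = 2 * c , widen
  where
  widen : ∀ k → ∃ λ N → ∀ x → N ≤ x → Gap (λ z → Any (z ∈_) (A ∷ As)) k x (2 * c * k)
  widen k with generator-gap {A} g (c * k) | gaps k
  ... | M , gapA | N , gapAs = M ⊔ N , window
    where
    window : ∀ x → M ⊔ N ≤ x → Gap (λ z → Any (z ∈_) (A ∷ As)) k x (2 * c * k)
    window x M⊔N≤x with gapA x (m⊔n≤o⇒m≤o M N M⊔N≤x)
    ... | u , x≤u , u+≤ , avoidsA
      with gapAs u (≤-trans (m⊔n≤o⇒n≤o M N M⊔N≤x) x≤u)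
    ... | v , u≤v , v+≤ , avoidsAs = v , ≤-trans x≤u u≤v
      , ≤-trans v+≤ (≤-trans u+≤ (≤-reflexive (cong (x +_) (sym (*-assoc 2 c k)))))
      , λ z v≤z z<v+k → λ where
          (here z∈A)   → avoidsA z (≤-trans u≤v v≤z) (<-≤-trans z<v+k v+≤) z∈A
          (there z∈As) → avoidsAs z v≤z z<v+k z∈As

𝓛-gap : ∀ X → X ∈ᴵ 𝓛 → ∃ λ c → ∀ k → ∃ λ N → ∀ x → N ≤ x → Gap (_∈ X) k x (c * k)
𝓛-gap X (As , gens , cover) with generators-gap gens
... | c , gaps = c , λ k → gaps k .proj₁ , λ x N≤x →
  let y , x≤y , y+k≤ , avoids = gaps k .proj₂ x N≤x
  in  y , x≤y , y+k≤ , λ z y≤z z<y+k z∈X → avoids z y≤z z<y+k (cover z z∈X)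

-- Lacunary sets given by decidable predicates.

module _ {P : Pred ℕ 0ℓ} (P? : Decidable P) where

  LeastFrom : ℕ → Set
  LeastFrom x = ∃ λ y → x ≤ y × P y × ∀ z → x ≤ z → P z → y ≤ z

  least : ∀ x y → x ≤ y → P y → LeastFrom x
  least x = <-rec (λ y → x ≤ y → P y → LeastFrom x) λ y rec x≤y Py →
    search y rec x≤y Py (anyUpTo? (λ i → (x ≤? i) ×-dec P? i) y)
    where
    search : ∀ y → (∀ {i} → i < y → x ≤ i → P i → LeastFrom x) → x ≤ y → P y →
             Dec (∃ λ i → i < y × x ≤ i × P i) → LeastFrom x
    search y rec _   _  (yes (i , i<y , x≤i , Pi)) = rec i<y x≤i Pi
    search y rec x≤y Py (no none) = y , x≤y , Py , λ z x≤z Pz →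
      ≮⇒≥ λ z<y → none (z , z<y , x≤z , Pz)

  module _ (unbounded : ∀ x → ∃ λ y → x ≤ y × P y) where

    from : ∀ x → LeastFrom x
    from x = let y , x≤y , Py = unbounded x in least x y x≤y Py

    enumeration : ℕ → ℕ
    enumeration zero    = from 0 .proj₁
    enumeration (suc n) = from (suc (enumeration n)) .proj₁

    enumeration-∈ : ∀ n → P (enumeration n)
    enumeration-∈ zero    = from 0 .proj₂ .proj₂ .proj₁
    enumeration-∈ (suc n) = from (suc (enumeration n)) .proj₂ .proj₂ .proj₁

    enumeration-inc : ∀ n → enumeration n < enumeration (suc n)
    enumeration-inc n = from (suc (enumeration n)) .proj₂ .proj₁

    enumeration-hits : ∀ {x} → P x → ∀ n → (∃ λ i → enumeration i ≡ x) ⊎ enumeration n ≤ x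
    enumeration-hits {x} Px zero = inj₂ (from 0 .proj₂ .proj₂ .proj₂ x z≤n Px)
    enumeration-hits {x} Px (suc n) with enumeration-hits Px n
    ... | inj₁ hit = inj₁ hit
    ... | inj₂ en≤x with m≤n⇒m<n∨m≡n en≤x
    ... | inj₁ en<x = inj₂ (from (suc (enumeration n)) .proj₂ .proj₂ .proj₂ x en<x Px)
    ... | inj₂ en≡x = inj₁ (n , en≡x)

    increasingEnumeration : IncreasingEnumeration enumeration ⟦ P ⟧
    increasingEnumeration = enumeration-inc , λ x → mk⇔
      -- At stage `suc x` the second alternative fails, because `n ≤ enumeration n` for all `n`.
      (λ Px → [ id , (λ e≤x → contradiction
          (increasing⇒inflationary enumeration-inc (suc x)) (<⇒≱ (s≤s e≤x))) ]′
        (enumeration-hits Px (suc x)))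
      λ (n , en≡x) → subst P en≡x (enumeration-∈ n)

    spread⇒lacunary :
      (∀ D → ∃ λ N → ∀ x y → P x → P y → N ≤ x → x < y → D ≤ y ∸ x) → Lacunary ⟦ P ⟧
    spread⇒lacunary spread = enumeration , increasingEnumeration , λ D →
      spread D .proj₁ , λ n N≤n → spread D .proj₂ _ _
        (enumeration-∈ n) (enumeration-∈ (suc n))
        (≤-trans N≤n (increasing⇒inflationary enumeration-inc n)) (enumeration-inc n)

-- The bound k ≤ x, redundant when 2^k ≤ t k, makes the predicate decidable.
EventuallyDivisible : (ℕ → ℕ) → Pred ℕ 0ℓ
EventuallyDivisible t x = ∀ {k} → k < suc x → t k ≤ x → 2 ^ k ∣ x

-- Two distinct elements beyond `t D` are both divisible by `2 ^ D`, so they differ by at least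
-- `2 ^ D`, which exceeds `D`.
eventuallyDivisible-lacunary : ∀ t → (∀ k → 2 ^ k ≤ t k) → Lacunary ⟦ EventuallyDivisible t ⟧
eventuallyDivisible-lacunary t 2^k≤t = spread⇒lacunary
  (λ x → allUpTo? (λ k → (t k ≤? x) →-dec (2 ^ k ∣? x)) (suc x))
  -- Powers of two are elements: as `2 ^ k ≤ t k`, `t k ≤ 2 ^ x` forces `k ≤ x`.
  (λ x → 2 ^ x , <⇒≤ (n<2^n x) , λ {k} _ tk≤ →
    m≤n⇒2^m∣2^n {k} {x} (≮⇒≥ λ x<k →
      <⇒≱ (^-monoʳ-< 2 (s≤s (s≤s z≤n)) x<k) (≤-trans (2^k≤t k) tk≤)))
  λ D → t D , λ x y Px Py tD≤x x<y →
    let D<x = <-≤-trans (n<2^n D) (≤-trans (2^k≤t D) tD≤x)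
        2^D∣y∸x = ∣m∣n⇒∣n∸m (<⇒≤ x<y)
          (Py (m<n⇒m<1+n (<-trans D<x x<y)) (≤-trans tD≤x (<⇒≤ x<y)))
          (Px (m<n⇒m<1+n D<x) tD≤x)
    in  ≤-trans (<⇒≤ (n<2^n D)) (∣⇒≤ {{>-nonZero (m<n⇒0<n∸m x<y)}} 2^D∣y∸x)
  where
  ∣m∣n⇒∣n∸m : ∀ {d x y} → x ≤ y → d ∣ y → d ∣ x → d ∣ y ∸ x
  ∣m∣n⇒∣n∸m x≤y d∣y d∣x = ∣m+n∣m⇒∣n (subst (_ ∣_) (sym (m+[n∸m]≡n x≤y)) d∣y) d∣x

-- The set `A` and its positivity.

A : Subset ω
A = ⟦ (λ x → ∃ λ k → ∃ λ n → ∃ λ j → j < 2 ^ k × x ≡ 2 ^ k * (2 ^ n + j)) ⟧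

-- A gap of length `2 ^ c` contains a multiple of `2 ^ c`. In a window of length `c * 2 ^ c`
-- starting at `2 ^ c * 2 ^ N`, these multiples are `2 ^ c * (2 ^ N + j)` with `j < c < 2 ^ c`,
-- hence all in `A`.
A∈⁺𝓛 : A ∈⁺ 𝓛
A∈⁺𝓛 A∈𝓛 with 𝓛-gap A A∈𝓛
... | c , gaps with gaps (2 ^ c)
... | N , window with window (2 ^ c * 2 ^ N)
      (≤-trans (<⇒≤ (n<2^n N)) (m≤n*m (2 ^ N) (2 ^ c) {{m^n≢0 2 c}}))
... | y , x≤y , y+≤ , avoids with nearest-multiple (2 ^ c) {{m^n≢0 2 c}} y
... | q , y≤dq , dq<y+d = avoids (2 ^ c * q) y≤dq dq<y+d
  (c , N , q ∸ 2 ^ N , <-trans j<c (n<2^n c) , cong (2 ^ c *_) (sym (m+[n∸m]≡n 2^N≤q)))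
  where
  2^N≤q : 2 ^ N ≤ q
  2^N≤q = *-cancelˡ-≤ (2 ^ c) {{m^n≢0 2 c}} (≤-trans x≤y y≤dq)

  q<2^N+c : q < 2 ^ N + c
  q<2^N+c = *-cancelˡ-< (2 ^ c) _ _ (begin-strict
    2 ^ c * q                     <⟨ dq<y+d ⟩
    y + 2 ^ c                     ≤⟨ y+≤ ⟩
    2 ^ c * 2 ^ N + c * 2 ^ c     ≡⟨ cong (2 ^ c * 2 ^ N +_) (*-comm c (2 ^ c)) ⟩
    2 ^ c * 2 ^ N + 2 ^ c * c     ≡⟨ *-distribˡ-+ (2 ^ c) (2 ^ N) c ⟨
    2 ^ c * (2 ^ N + c)           ∎)
    where open ≤-Reasoning

  j<c : q ∸ 2 ^ N < c
  j<c = +-cancelˡ-< (2 ^ N) _ _ (subst (_< 2 ^ N + c) (sym (m+[n∸m]≡n 2^N≤q)) q<2^N+c)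

-- Elements of `A` close to a power of two.

shiftedPowers : ℕ → Subset ω
shiftedPowers r = ⟦ (λ x → ∃ λ p → 2 ^ p + r ≡ x) ⟧

shiftedPowers-lacunary : ∀ r → Lacunary (shiftedPowers r)
shiftedPowers-lacunary r = (λ p → 2 ^ p + r)
  , ((λ p → +-monoˡ-< r (^-monoʳ-< 2 (s≤s (s≤s z≤n)) (n<1+n p))) , λ x → mk⇔ id id)
  , λ M → M , λ p M≤p → begin
      M                                ≤⟨ M≤p ⟩
      p                                ≤⟨ <⇒≤ (n<2^n p) ⟩
      2 ^ p                            ≡⟨ m+n∸m≡n (2 ^ p) (2 ^ p) ⟨
      2 ^ p + 2 ^ p ∸ 2 ^ p            ≡⟨ cong (λ n → 2 ^ p + n ∸ 2 ^ p) (+-identityʳ (2 ^ p)) ⟨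
      2 ^ suc p ∸ 2 ^ p                ≡⟨ [m+n]∸[o+n]≡m∸o (2 ^ suc p) r (2 ^ p) ⟨
      2 ^ suc p + r ∸ (2 ^ p + r)      ∎
  where
  open ≤-Reasoning
  [m+n]∸[o+n]≡m∸o : ∀ m n o → m + n ∸ (o + n) ≡ m ∸ o
  [m+n]∸[o+n]≡m∸o m n o rewrite +-comm m n | +-comm o n = [m+n]∸[m+o]≡n∸o n m o

nearPowers : ℕ → Subset ω
nearPowers k = ⟦ (λ x → ∃ λ r → r < 2 ^ k * 2 ^ k × x ∈ shiftedPowers r) ⟧

nearPowers∈𝓛 : ∀ k → nearPowers k ∈ᴵ 𝓛
nearPowers∈𝓛 k = map shiftedPowers (upTo (2 ^ k * 2 ^ k))
  , All.map⁺ (All.universal (inj₁ ∘ shiftedPowers-lacunary) _)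
  , λ _ (_ , r< , x∈) → Any.map⁺ (List.lose (∈-upTo⁺ r<) x∈)

-- If `k ≤ l`, the factor `2 ^ l` gives divisibility. Otherwise the element is
-- `2 ^ (l + n) + 2 ^ l * j`, whose second summand is below `2 ^ k * 2 ^ k`.
A∖nearPowers : ∀ k {x} → x ∈ A → ¬ x ∈ nearPowers k → 2 ^ k ∣ x
A∖nearPowers k {x} (l , n , j , j<2^l , x≡) x∉ with k ≤? l
... | yes k≤l = subst (2 ^ k ∣_) (sym x≡) (∣m⇒∣m*n _ (m≤n⇒2^m∣2^n k≤l))
... | no  k≰l = contradiction (2 ^ l * j , r< , l + n , x≡′) x∉
  where
  2^l≤2^k : 2 ^ l ≤ 2 ^ k
  2^l≤2^k = ^-monoʳ-≤ 2 (<⇒≤ (≰⇒> k≰l))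

  r< : 2 ^ l * j < 2 ^ k * 2 ^ k
  r< = <-≤-trans (*-monoʳ-< (2 ^ l) {{m^n≢0 2 l}} j<2^l) (*-mono-≤ 2^l≤2^k 2^l≤2^k)

  x≡′ : 2 ^ (l + n) + 2 ^ l * j ≡ x
  x≡′ = trans (cong (_+ 2 ^ l * j) (^-distribˡ-+-* 2 l n))
    (trans (sym (*-distribˡ-+ (2 ^ l) (2 ^ n) j)) (sym x≡))

-- Excluding a reduction.

_⁻¹[_] : (ℕ → ℕ) → Subset ω → Subset ω
f ⁻¹[ B ] = ⟦ (λ x → f x ∈ B) ⟧

no-reduction : (f : ℕ → ℕ) → (∀ x → f x ∈ A) → ¬ (∀ B → B ∈ᴵ 𝓛 → f ⁻¹[ B ] ∈ᴵ 𝓛)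
no-reduction f f∈A reduces = contradiction (avoids y ≤-refl (m<m+n y (s≤s z≤n)))
  λ y∉E → y∉E (λ {k} _ → f-divides y∈J k)
  where
  interval : ∀ k → ∃ λ y → k ≤ y × ∀ z → y ≤ z → z < y + k → 2 ^ k ∣ f z
  interval k =
    let _ , gaps = 𝓛-gap (f ⁻¹[ nearPowers k ]) (reduces (nearPowers k) (nearPowers∈𝓛 k))
        N , window = gaps k
        -- Starting beyond `k` as well as `N` makes the intervals move off to infinity.
        y , N⊔k≤y , _ , avoids = window (N ⊔ k) (m≤m⊔n N k)
    in  y , m⊔n≤o⇒n≤o N k N⊔k≤y
      , λ z y≤z z<y+k → A∖nearPowers k (f∈A z) (avoids z y≤z z<y+k)

  left : ℕ → ℕ
  left k = interval k .proj₁

  -- The second summand exceeds all values of `f` on the intervals with index below `k`; the first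
  -- ensures `2 ^ k ≤ t k`.
  t : ℕ → ℕ
  t k = 2 ^ k + suc (maxBelow f (maxBelow (λ j → left j + j) k))

  J : ℕ → Pred ℕ 0ℓ
  J k z = left k ≤ z × z < left k + k

  -- By the choice of `t`, `t k ≤ f z` rules out `j < k`, so `2 ^ k` divides `2 ^ j`, which divides
  -- `f z`. Hence `f` maps every interval into `E`.
  f-divides : ∀ {j z} → J j z → ∀ k → t k ≤ f z → 2 ^ k ∣ f z
  f-divides {j} {z} (≤z , z<) k tk≤fz =
    ∣-trans (m≤n⇒2^m∣2^n k≤j) (interval j .proj₂ .proj₂ z ≤z z<)
    where
    k≤j : k ≤ j
    k≤j = ≮⇒≥ λ j<k → <⇒≱
      (≤-trans (s≤s (≤-maxBelow f (<-≤-trans z< (≤-maxBelow (λ i → left i + i) j<k))))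
        (m≤n+m _ (2 ^ k)))
      tk≤fz

  E : Subset ω
  E = ⟦ EventuallyDivisible t ⟧

  E∈𝓛 : E ∈ᴵ 𝓛
  E∈𝓛 = E ∷ [] , inj₁ (eventuallyDivisible-lacunary t λ k → m≤m+n (2 ^ k) _) ∷ [] , λ _ → here

  gaps = 𝓛-gap (f ⁻¹[ E ]) (reduces E E∈𝓛)
  c = gaps .proj₁
  -- A gap of length 1 suffices: its point `y` lies in `J K` but outside the preimage of `E`. In
  -- `K`, the summand `c` lets the interval contain the window, and `N` puts it far enough out.
  N = gaps .proj₂ 1 .proj₁
  K = c + N
  gap = gaps .proj₂ 1 .proj₂ (left K) (≤-trans (m≤n+m N c) (interval K .proj₂ .proj₁))
  y = gap .proj₁
  avoids = gap .proj₂ .proj₂ .proj₂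

  y∈J : J K y
  y∈J = gap .proj₂ .proj₁ , (begin
    suc y             ≡⟨ +-comm 1 y ⟩
    y + 1             ≤⟨ gap .proj₂ .proj₂ .proj₁ ⟩
    left K + c * 1   ≡⟨ cong (left K +_) (*-identityʳ c) ⟩
    left K + c       ≤⟨ +-monoʳ-≤ (left K) (m≤m+n c N) ⟩
    left K + K       ∎)
    where open ≤-Reasoning

-- Each `B` in `𝓛` has its trace on `A` in the restricted ideal, so `f`, read as a map from `ω` to
-- itself with values in `A`, pulls `𝓛` back into `𝓛`.
𝓛↾A≰K𝓛 : ¬ (restrict 𝓛 A A∈⁺𝓛 ≤K 𝓛)
𝓛↾A≰K𝓛 (f , reduces) = no-reduction (proj₁ ∘ to) (proj₂ ∘ to) λ B B∈𝓛 →
  let trace = record { pred = λ a → proj₁ a ∈ B ; resp = resp B }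
  in  ⊆-closed 𝓛 ((proj₁ ∘ to) ⁻¹[ B ]) (preimage f trace) (λ _ → id)
        (reduces trace (B , B∈𝓛 , λ _ → mk⇔ id id))
  where open Func f

proposition10p3 : (¬ ≤K-Homogeneous 𝓛) × (¬ Homogeneous 𝓛)
proposition10p3 =
    (λ hom → 𝓛↾A≰K𝓛 (hom A A∈⁺𝓛 .proj₁))
  -- Read from right to left, the equivalence in an isomorphism is a Katětov reduction.
  , λ hom → let f , iso = hom A A∈⁺𝓛
            in  𝓛↾A≰K𝓛 (Injection.function (Bijection.injection f) , λ B → Equivalence.from (iso B))
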